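{- There is a finite set $\mathcal{F}$ of vertex-coloured stars such that $\textsc{QPoly}\le_p\textsc{HomRec}(\mathcal{F})$.
   Context: A vertex-coloured graph is a graph with a map $c\colon V(G)\to\mathcal{C}$ to a set of colours; homomorphisms between coloured graphs are colour-preserving graph homomorphisms, $\hom(F,G)$ counts them. A star is a tree with at most one non-leaf vertex. $\textsc{HomRec}(\mathcal{F})$: given pairs $(F_1,h_1),\dots,(F_m,h_m)\in\mathcal{F}\times\mathbb{N}$ (numbers in binary), decide whether there is a coloured graph $G$ with $\hom(F_i,G)=h_i$ for all $i$. $\textsc{QPoly}$: given natural numbers $a,b,c$ in binary, decide whether there are $x,y\in\mathbb{N}$ with $ax^2+by=c$. $\le_p$ denotes polynomial-time many-one reducibility. -}

module Defs where

open import Data.Nat using (ℕ; zero; suc; _+_; _*_; _^_; _≤_)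
open import Data.Nat.Binary using (ℕᵇ; 2[1+_]; 1+[2_]) renaming (zero to zeroᵇ; fromℕ to toBin)
open import Data.Bool using (Bool; true; false; _∧_; _∨_; not)
open import Data.Fin using (Fin; toℕ) renaming (zero to fzero; suc to fsuc)
open import Data.List using (List; []; _∷_; _++_; map; concatMap; length; filter; allFin; concat; lookup)
open import Data.Vec as Vec using (Vec)
open import Data.Maybe using (Maybe; just; nothing)
open import Data.Product using (Σ; _×_; _,_; ∃)
open import Data.Sum using (_⊎_)
open import Data.List.Relation.Unary.All using (All)
open import Relation.Binary.PropositionalEquality using (_≡_; _≢_)
open import Relation.Nullary using (does)
open import Function.Bundles using (_⇔_)
import Data.Nat as N

record CGraph : Set where
  field
    n      : ℕ
    adj    : Fin n → Fin n → Bool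
    adjSym : ∀ u v → adj u v ≡ adj v u
    noLoop : ∀ v → adj v v ≡ false
    col    : Fin n → ℕ
open CGraph public

allMaps : (k m : ℕ) → List (Vec (Fin m) k)
allMaps zero    m = Vec.[] ∷ []
allMaps (suc k) m = concatMap (λ i → map (i Vec.∷_) (allMaps k m)) (allFin m)

allB : {A : Set} → (A → Bool) → List A → Bool
allB p []       = true
allB p (x ∷ xs) = p x ∧ allB p xs

isHom : (F G : CGraph) → (Fin (n F) → Fin (n G)) → Bool
isHom F G f =
  allB (λ u → does (col F u N.≟ col G (f u))
             ∧ allB (λ v → not (adj F u v) ∨ adj G (f u) (f v)) (allFin (n F)))
      (allFin (n F))

hom : CGraph → CGraph → ℕ
hom F G = length (filter (λ v → isHom F G (Vec.lookup v) Data.Bool.≟ true) (allMaps (n F) (n G)))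
  where import Data.Bool

-- A star: a tree with at most one non-leaf vertex, i.e. there is a
-- centre c adjacent to every other vertex and every edge contains c.
IsStar : CGraph → Set
IsStar F = Σ (Fin (n F)) λ c →
  (∀ u v → adj F u v ≡ true → u ≡ c ⊎ v ≡ c) × (∀ v → v ≢ c → adj F c v ≡ true)

Word : Set
Word = List Bool

Language : Set₁
Language = Word → Set

-- (bijective) binary digits of a number
binDigits : ℕᵇ → Word
binDigits zeroᵇ    = []
binDigits 2[1+ x ] = true ∷ binDigits x
binDigits 1+[2 x ] = false ∷ binDigits x

selfDelim : Word → Word
selfDelim []       = false ∷ true ∷ []
selfDelim (b ∷ bs) = b ∷ b ∷ selfDelim bs

encℕ : ℕ → Word
encℕ x = selfDelim (binDigits (toBin x))

QPolyYes : ℕ → ℕ → ℕ → Set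
QPolyYes a b c = Σ ℕ λ x → Σ ℕ λ y → a * (x * x) + b * y ≡ c

encQPoly : ℕ → ℕ → ℕ → Word
encQPoly a b c = encℕ a ++ encℕ b ++ encℕ c

QPoly : Language
QPoly w = Σ ℕ λ a → Σ ℕ λ b → Σ ℕ λ c → encQPoly a b c ≡ w × QPolyYes a b c

HomRecInstance : List CGraph → Set
HomRecInstance 𝓕 = List (Fin (length 𝓕) × ℕ)

HomRecYes : (𝓕 : List CGraph) → HomRecInstance 𝓕 → Set
HomRecYes 𝓕 I = Σ CGraph λ G → All (λ p → hom (lookup 𝓕 (Data.Product.proj₁ p)) G ≡ Data.Product.proj₂ p) I
  where import Data.Product

encHomRec : (𝓕 : List CGraph) → HomRecInstance 𝓕 → Word
encHomRec 𝓕 I = concat (map (λ p → encℕ (toℕ (Data.Product.proj₁ p)) ++ encℕ (Data.Product.proj₂ p)) I)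
  where import Data.Product

HomRec : List CGraph → Language
HomRec 𝓕 w = Σ (HomRecInstance 𝓕) λ I → encHomRec 𝓕 I ≡ w × HomRecYes 𝓕 I

-- Single-tape deterministic Turing machines.
-- Tape symbols Fin (3 + Γ): 0 = blank, 1 = bit false, 2 = bit true.

data Move : Set where
  moveL moveR stay : Move

record TM : Set where
  field
    Q     : ℕ
    Γ     : ℕ
    start : Fin Q
    -- next state (nothing = halt), written symbol, head move
    δ     : Fin Q → Fin (3 + Γ) → Maybe (Fin Q) × Fin (3 + Γ) × Move

module _ (M : TM) where
  open TM M

  Sym : Set
  Sym = Fin (3 + Γ)

  blank : Sym
  blank = fzero

  bitSym : Bool → Sym
  bitSym false = fsuc fzero
  bitSym true  = fsuc (fsuc fzero)

  record Config : Set where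
    constructor config
    field
      state : Maybe (Fin Q)
      left  : List Sym    -- cells left of head, nearest first
      head  : Sym
      right : List Sym    -- cells right of head, nearest first

  move : Move → List Sym → Sym → List Sym → Maybe (Fin Q) → Config
  move moveL []       s r q = config q [] blank (s ∷ r)
  move moveL (x ∷ l)  s r q = config q l x (s ∷ r)
  move moveR l s []       q = config q (s ∷ l) blank []
  move moveR l s (x ∷ r)  q = config q (s ∷ l) x r
  move stay  l s r        q = config q l s r

  step : Config → Config
  step (config nothing l h r)  = config nothing l h r
  step (config (just q) l h r) with δ q h
  ... | q' , s , m = move m l s r q'

  run : ℕ → Config → Config
  run zero    c = c
  run (suc t) c = run t (step c)

  initial : Word → Config
  initial []       = config (just start) [] blank []
  initial (b ∷ bs) = config (just start) [] (bitSym b) (map bitSym bs)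

  readBits : List Sym → Word
  readBits [] = []
  readBits (fsuc fzero ∷ xs)        = false ∷ readBits xs
  readBits (fsuc (fsuc fzero) ∷ xs) = true ∷ readBits xs
  readBits (_ ∷ xs) = []

  output : Config → Word
  output (config _ _ h r) = readBits (h ∷ r)

  halted : Config → Set
  halted c = Config.state c ≡ nothing

  ComputesIn : (Word → Word) → (ℕ → ℕ) → Set
  ComputesIn f T = ∀ x → Σ ℕ λ t → t ≤ T (length x)
                     × halted (run t (initial x)) × output (run t (initial x)) ≡ f x

PolyTimeComputable : (Word → Word) → Set
PolyTimeComputable f = Σ TM λ M → Σ ℕ λ k → ComputesIn M f (λ m → m ^ k + k)

_≤ₚ_ : Language → Language → Set
A ≤ₚ B = Σ (Word → Word) λ f → PolyTimeComputable f × (∀ w → A w ⇔ B (f w))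

{-# OPTIONS --safe #-}
-- For a star with centre colour 0 and leaf colours c₁, …, cₖ, the number of
-- homomorphisms to G is the sum over the vertices v of colour 0 of the product
-- of the degrees of v into the classes c₁, …, cₖ.  Constant counts force G to
-- have exactly two vertices p and q of colour 0, told apart by marker leaves, so
-- that degrees of p and of q can be prescribed separately.  With the degrees
-- (a, x, 1) for p and (b, 1, y) for q, where x and y stay free, the star whose
-- leaves use these three colours with multiplicities 1, 2, 1 counts a x² + b y.
-- On encodings the reduction only inserts constant words before the encodings of
-- a, b and c, which a Turing machine does in one pass with a bounded queue.
module Submission where

open import Defs
open import Data.Bool using (Bool; true; false; _∧_; _∨_; not; if_then_else_)
import Data.Bool as Bool
open import Data.Bool.Properties using (⇔→≡)
open import Data.Fin using (Fin; zero; suc; toℕ; #_)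
open import Data.Fin.Properties using (+↔⊎; *↔×; 2↔Bool; toℕ-injective)
open import Data.List using (List; []; _∷_; _++_; map; concatMap; length; filter; allFin; tabulate; lookup; replicate; drop; _ʳ++_)
open import Data.List.Properties using (filter-none; filter-++; map-cong; map-++; map-ʳ++; length-map; length-++; length-ʳ++; ++-assoc; ++-identityʳ; ʳ++-ʳ++; ∷-injectiveˡ; ∷-injectiveʳ)
open import Data.List.Relation.Unary.All as All using (All; []; _∷_; universal)
open import Data.List.Relation.Unary.All.Properties using (map⁺; tabulate⁺)
open import Data.Maybe as Maybe using (Maybe; just; nothing; maybe′)
open import Data.Maybe.Properties using (map-∘)
open import Data.Nat using (ℕ; zero; suc; _+_; _*_; _^_; _≤_; z≤n; s≤s; _≟_)
open import Data.Nat.Binary using (ℕᵇ; 2[1+_]; 1+[2_]) renaming (zero to zeroᵇ; fromℕ to toBin; toℕ to toℕᵇ)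
open import Data.Nat.Binary.Properties using (fromℕ-toℕ; fromℕ-injective)
open import Data.Nat.ListAction using (sum; product)
open import Data.Nat.Properties using (+-identityʳ; +-suc; +-assoc; *-comm; *-identityʳ; *-monoʳ-≤; +-mono-≤; m≤m+n; m≤n+m; m^n>0; ≤-refl; ≤-reflexive; ≤-trans; module ≤-Reasoning)
open import Data.Nat.Solver using (module +-*-Solver)
open import Data.Product using (Σ; _×_; _,_; proj₁; proj₂)
open import Data.Product.Function.NonDependent.Propositional using (_×-↪_)
open import Data.Sum using (_⊎_; inj₁; inj₂)
open import Data.Sum.Function.Propositional using (_⊎-↪_)
open import Data.Vec as Vec using (Vec; []; _∷_; _∷ʳ_; toList; fromList)
open import Data.Vec.Properties using (toList-++; toList-∷ʳ; toList-map; toList-cast; toList∘fromList; length-toList)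
open import Function using (_∘_; id)
open import Function.Bundles using (_⇔_; _↪_; mk⇔; mk↪; RightInverse)
open import Function.Construct.Composition using (_↪-∘_)
open import Function.Properties.Inverse using (↔⇒↪; ↔-sym)
open import Relation.Binary.PropositionalEquality using (_≡_; _≢_; refl; sym; trans; cong; cong₂; _≗_; module ≡-Reasoning)
open import Relation.Nullary using (does; contradiction)

private variable
  A B : Set

-- Counting the elements of a list that pass a boolean test

-- The body has the shape of `hom`, so `hom F G` unfolds to a `count` over `allMaps` and the lemmas
-- below apply to it by conversion.
count : (A → Bool) → List A → ℕ
count p xs = length (filter (λ x → p x Bool.≟ true) xs)

count-∷ : (p : A → Bool) (x : A) (xs : List A) →
          count p (x ∷ xs) ≡ (if p x then 1 else 0) + count p xs
count-∷ p x xs with p x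
... | true  = refl
... | false = refl

count-++ : (p : A → Bool) (xs ys : List A) → count p (xs ++ ys) ≡ count p xs + count p ys
count-++ p xs ys = trans (cong length (filter-++ _ xs ys)) (length-++ (filter (λ x → p x Bool.≟ true) xs))

count-cong : {p q : A → Bool} → p ≗ q → count p ≗ count q
count-cong p≗q [] = refl
count-cong {p = p} {q} p≗q (x ∷ xs)
  rewrite count-∷ p x xs | count-∷ q x xs | p≗q x = cong (_ +_) (count-cong p≗q xs)

count-map : (p : B → Bool) (f : A → B) (xs : List A) → count p (map f xs) ≡ count (p ∘ f) xs
count-map p f [] = refl
count-map p f (x ∷ xs)
  rewrite count-∷ p (f x) (map f xs) | count-∷ (p ∘ f) x xs = cong (_ +_) (count-map p f xs)

count-concatMap : (p : B → Bool) (f : A → List B) (xs : List A) →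
                  count p (concatMap f xs) ≡ sum (map (count p ∘ f) xs)
count-concatMap p f [] = refl
count-concatMap p f (x ∷ xs) =
  trans (count-++ p (f x) (concatMap f xs)) (cong (_ +_) (count-concatMap p f xs))

count-false : (xs : List A) → count (λ _ → false) xs ≡ 0
count-false []       = refl
count-false (x ∷ xs) = count-false xs

count-guard : (b : Bool) (p : A → Bool) (xs : List A) →
              count (λ x → b ∧ p x) xs ≡ (if b then count p xs else 0)
count-guard true  p xs = refl
count-guard false p xs = count-false xs

count-replicate : (p : A → Bool) (k : ℕ) (x : A) → count p (replicate k x) ≡ (if p x then k else 0)
count-replicate p zero x with p x
... | true  = refl
... | false = refl
count-replicate p (suc k) x
  rewrite count-∷ p x (replicate k x) | count-replicate p k x with p x
... | true  = refl
... | false = refl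

sum-guard : (p : A → Bool) (c : ℕ) (xs : List A) →
            sum (map (λ x → if p x then c else 0) xs) ≡ count p xs * c
sum-guard p c [] = refl
sum-guard p c (x ∷ xs) rewrite count-∷ p x xs with p x
... | true  = cong (c +_) (sum-guard p c xs)
... | false = sum-guard p c xs

allB⁻ : (p : A → Bool) {n : ℕ} (f : Fin n → A) → allB p (tabulate f) ≡ true → ∀ i → p (f i) ≡ true
allB⁻ p f h zero    with p (f zero)
... | true = refl
allB⁻ p f h (suc i) with p (f zero)
... | true = allB⁻ p (f ∘ suc) h i

allB⁺ : (p : A → Bool) {n : ℕ} (f : Fin n → A) → (∀ i → p (f i) ≡ true) → allB p (tabulate f) ≡ true
allB⁺ p {zero}  f h = refl
allB⁺ p {suc n} f h rewrite h zero = allB⁺ p (f ∘ suc) (h ∘ suc)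

∧⁻ : (b c : Bool) → b ∧ c ≡ true → b ≡ true × c ≡ true
∧⁻ true true _ = refl , refl

∧⁺ : {b c : Bool} → b ≡ true → c ≡ true → b ∧ c ≡ true
∧⁺ refl refl = refl

-- Homomorphisms from a star to an arbitrary graph

-- Leaf colours are shifted by one, so that only centres have colour 0.
star : List ℕ → CGraph
star ls = record
  { n      = suc (length ls)
  ; adj    = edge
  ; adjSym = λ { zero zero → refl ; zero (suc _) → refl ; (suc _) zero → refl ; (suc _) (suc _) → refl }
  ; noLoop = λ { zero → refl ; (suc _) → refl }
  ; col    = λ { zero → 0 ; (suc i) → suc (lookup ls i) }
  }
  where
  edge : Fin (suc (length ls)) → Fin (suc (length ls)) → Bool
  edge zero    zero    = false
  edge zero    (suc _) = true
  edge (suc _) zero    = true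
  edge (suc _) (suc _) = false

star-isStar : (ls : List ℕ) → IsStar (star ls)
star-isStar ls = zero , onCentre , toCentre
  where
  onCentre : ∀ u v → adj (star ls) u v ≡ true → u ≡ zero ⊎ v ≡ zero
  onCentre zero    v       _ = inj₁ refl
  onCentre (suc u) zero    _ = inj₂ refl

  toCentre : ∀ v → v ≢ zero → adj (star ls) zero v ≡ true
  toCentre zero    v≢0 = contradiction refl v≢0
  toCentre (suc v) _   = refl

matches : (ℕ → A → Bool) → (ls : List ℕ) → Vec A (length ls) → Bool
matches p []       []      = true
matches p (l ∷ ls) (x ∷ v) = p l x ∧ matches p ls v

matches⁻ : (p : ℕ → A → Bool) (ls : List ℕ) (v : Vec A (length ls)) →
           matches p ls v ≡ true → ∀ i → p (lookup ls i) (Vec.lookup v i) ≡ true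
matches⁻ p (l ∷ ls) (x ∷ v) h zero    = proj₁ (∧⁻ (p l x) _ h)
matches⁻ p (l ∷ ls) (x ∷ v) h (suc i) = matches⁻ p ls v (proj₂ (∧⁻ (p l x) _ h)) i

matches⁺ : (p : ℕ → A → Bool) (ls : List ℕ) (v : Vec A (length ls)) →
           (∀ i → p (lookup ls i) (Vec.lookup v i) ≡ true) → matches p ls v ≡ true
matches⁺ p []       []      h = refl
matches⁺ p (l ∷ ls) (x ∷ v) h = ∧⁺ (h zero) (matches⁺ p ls v (h ∘ suc))

-- The images of the leaves are chosen independently, and `allMaps` splits off the first coordinate,
-- so the count factors one leaf at a time.
count-matches : (m : ℕ) (p : ℕ → Fin m → Bool) (ls : List ℕ) →
                count (matches p ls) (allMaps (length ls) m) ≡ product (map (λ l → count (p l) (allFin m)) ls)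
count-matches m p []       = refl
count-matches m p (l ∷ ls) = begin
  count (matches p (l ∷ ls)) (allMaps (suc (length ls)) m)
    ≡⟨ count-concatMap _ (λ i → map (i ∷_) (allMaps (length ls) m)) (allFin m) ⟩
  sum (map (λ i → count (matches p (l ∷ ls)) (map (i ∷_) (allMaps (length ls) m))) (allFin m))
    ≡⟨ cong sum (map-cong first (allFin m)) ⟩
  sum (map (λ i → if p l i then rest else 0) (allFin m))
    ≡⟨ sum-guard (p l) rest (allFin m) ⟩
  count (p l) (allFin m) * rest
    ≡⟨ cong (count (p l) (allFin m) *_) (count-matches m p ls) ⟩
  count (p l) (allFin m) * product (map (λ l → count (p l) (allFin m)) ls) ∎
  where
  open ≡-Reasoning
  rest : ℕ
  rest = count (matches p ls) (allMaps (length ls) m)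

  first : ∀ i → count (matches p (l ∷ ls)) (map (i ∷_) (allMaps (length ls) m)) ≡ (if p l i then rest else 0)
  first i = trans (count-map _ (i ∷_) (allMaps (length ls) m))
                  (count-guard (p l i) (matches p ls) (allMaps (length ls) m))

isLeaf : (G : CGraph) → Fin (n G) → ℕ → Fin (n G) → Bool
isLeaf G v l u = adj G v u ∧ does (suc l ≟ col G u)

deg : (G : CGraph) → Fin (n G) → ℕ → ℕ
deg G v l = count (isLeaf G v l) (allFin (n G))

weight : (ℕ → ℕ) → List ℕ → ℕ
weight d ls = product (map d ls)

centres : (G : CGraph) → List (Fin (n G))
centres G = filter (λ v → 0 ≟ col G v) (allFin (n G))

-- Stars see of a graph only the degree functions of its vertices of colour 0. With a bare list `ds`
-- of such functions the equations can be solved without reference to the graph.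
starSum : List (ℕ → ℕ) → List ℕ → ℕ
starSum ds ls = sum (map (λ d → weight d ls) ds)

-- `isHom` tests all ordered pairs of vertices. In a star the edges are the pairs of the centre and
-- a leaf; one order is tested by `isLeaf`, the other follows from `adjSym G`.
isHom-star : (G : CGraph) (ls : List ℕ) (i : Fin (n G)) (v : Vec (Fin (n G)) (length ls)) →
             isHom (star ls) G (Vec.lookup (i ∷ v)) ≡ does (0 ≟ col G i) ∧ matches (isLeaf G i) ls v
isHom-star G ls i v = ⇔→≡ {z = true} (mk⇔ forward backward)
  where
  F = star ls
  φ = Vec.lookup (i ∷ v)

  edgeOK : Fin (n F) → Fin (n F) → Bool
  edgeOK u w = not (adj F u w) ∨ adj G (φ u) (φ w)

  vertexOK : Fin (n F) → Bool
  vertexOK u = does (col F u ≟ col G (φ u)) ∧ allB (edgeOK u) (allFin (n F))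

  forward : isHom F G φ ≡ true → does (0 ≟ col G i) ∧ matches (isLeaf G i) ls v ≡ true
  forward h = ∧⁺ (proj₁ (ok zero))
                 (matches⁺ _ ls v λ j → ∧⁺ (allB⁻ (edgeOK zero) id (proj₂ (ok zero)) (suc j)) (proj₁ (ok (suc j))))
    where
    ok : ∀ u → does (col F u ≟ col G (φ u)) ≡ true × allB (edgeOK u) (allFin (n F)) ≡ true
    ok u = ∧⁻ _ _ (allB⁻ vertexOK id h u)

  backward : does (0 ≟ col G i) ∧ matches (isLeaf G i) ls v ≡ true → isHom F G φ ≡ true
  backward h = allB⁺ vertexOK id λ u → ∧⁺ (colours u) (allB⁺ (edgeOK u) id (edges u))
    where
    leaf : ∀ j → adj G i (Vec.lookup v j) ≡ true × does (suc (lookup ls j) ≟ col G (Vec.lookup v j)) ≡ true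
    leaf j = ∧⁻ _ _ (matches⁻ _ ls v (proj₂ (∧⁻ (does (0 ≟ col G i)) _ h)) j)

    colours : ∀ u → does (col F u ≟ col G (φ u)) ≡ true
    colours zero    = proj₁ (∧⁻ _ _ h)
    colours (suc j) = proj₂ (leaf j)

    edges : ∀ u w → edgeOK u w ≡ true
    edges zero    zero    = refl
    edges zero    (suc j) = proj₁ (leaf j)
    edges (suc j) zero    = trans (adjSym G _ _) (proj₁ (leaf j))
    edges (suc _) (suc _) = refl

-- Homomorphisms are sorted by the image of the centre. Once it is fixed at a vertex of colour 0,
-- `count-matches` counts the placements of the leaves.
hom-star : (G : CGraph) (ls : List ℕ) → hom (star ls) G ≡ starSum (map (deg G) (centres G)) ls
hom-star G ls = begin
  hom (star ls) G
    ≡⟨ count-concatMap _ (λ i → map (i ∷_) vs) (allFin (n G)) ⟩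
  sum (map (λ i → count (λ v → isHom (star ls) G (Vec.lookup v)) (map (i ∷_) vs)) (allFin (n G)))
    ≡⟨ cong sum (map-cong atCentre (allFin (n G))) ⟩
  sum (map (λ i → if does (0 ≟ col G i) then weight (deg G i) ls else 0) (allFin (n G)))
    ≡⟨ restrict (allFin (n G)) ⟩
  starSum (map (deg G) (centres G)) ls ∎
  where
  open ≡-Reasoning
  vs : List (Vec (Fin (n G)) (length ls))
  vs = allMaps (length ls) (n G)

  atCentre : ∀ i → count (λ v → isHom (star ls) G (Vec.lookup v)) (map (i ∷_) vs)
                 ≡ (if does (0 ≟ col G i) then weight (deg G i) ls else 0)
  atCentre i = begin
    count (λ v → isHom (star ls) G (Vec.lookup v)) (map (i ∷_) vs)
      ≡⟨ count-map _ (i ∷_) vs ⟩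
    count (λ v → isHom (star ls) G (Vec.lookup (i ∷ v))) vs
      ≡⟨ count-cong (isHom-star G ls i) vs ⟩
    count (λ v → does (0 ≟ col G i) ∧ matches (isLeaf G i) ls v) vs
      ≡⟨ count-guard (does (0 ≟ col G i)) (matches (isLeaf G i) ls) vs ⟩
    (if does (0 ≟ col G i) then count (matches (isLeaf G i) ls) vs else 0)
      ≡⟨ cong (if does (0 ≟ col G i) then_else 0) (count-matches (n G) (isLeaf G i) ls) ⟩
    (if does (0 ≟ col G i) then weight (deg G i) ls else 0) ∎

  restrict : ∀ xs → sum (map (λ i → if does (0 ≟ col G i) then weight (deg G i) ls else 0) xs)
                  ≡ starSum (map (deg G) (filter (λ v → 0 ≟ col G v) xs)) ls
  restrict [] = refl
  restrict (x ∷ xs) with does (0 ≟ col G x)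
  ... | true  = cong (_ +_) (restrict xs)
  ... | false = restrict xs

-- A target graph made of two disjoint stars

-- The flag true marks the leaves of the first star.
twoStars : List (Bool × ℕ) → CGraph
twoStars ls = record
  { n      = 2 + length ls
  ; adj    = edge
  ; adjSym = λ { zero zero → refl ; zero (suc zero) → refl ; zero (suc (suc _)) → refl
               ; (suc zero) zero → refl ; (suc zero) (suc zero) → refl ; (suc zero) (suc (suc _)) → refl
               ; (suc (suc _)) zero → refl ; (suc (suc _)) (suc zero) → refl ; (suc (suc _)) (suc (suc _)) → refl }
  ; noLoop = λ { zero → refl ; (suc zero) → refl ; (suc (suc _)) → refl }
  ; col    = λ { zero → 0 ; (suc zero) → 0 ; (suc (suc i)) → suc (proj₂ (lookup ls i)) }
  }
  where
  edge : Fin (2 + length ls) → Fin (2 + length ls) → Bool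
  edge zero          (suc (suc i)) = proj₁ (lookup ls i)
  edge (suc zero)    (suc (suc i)) = not (proj₁ (lookup ls i))
  edge (suc (suc i)) zero          = proj₁ (lookup ls i)
  edge (suc (suc i)) (suc zero)    = not (proj₁ (lookup ls i))
  edge _             _             = false

centres-twoStars : (ls : List (Bool × ℕ)) → centres (twoStars ls) ≡ zero ∷ suc zero ∷ []
centres-twoStars ls = cong (λ xs → zero ∷ suc zero ∷ xs)
  (filter-none (λ v → 0 ≟ col (twoStars ls) v) (tabulate⁺ {f = λ i → suc (suc i)} λ _ ()))

ownLeaf : Bool → ℕ → Bool × ℕ → Bool
ownLeaf true  l (b , l′) = b ∧ does (l ≟ l′)
ownLeaf false l (b , l′) = not b ∧ does (l ≟ l′)

count-tabulate-lookup : (p : A → Bool) (xs : List A) →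
                        {f : Fin (length xs) → B} (q : B → Bool) → (∀ i → q (f i) ≡ p (lookup xs i)) →
                        count q (tabulate f) ≡ count p xs
count-tabulate-lookup p []       q h = refl
count-tabulate-lookup p (x ∷ xs) {f} q h
  rewrite count-∷ q (f zero) (tabulate (f ∘ suc)) | count-∷ p x xs | h zero =
  cong (_ +_) (count-tabulate-lookup p xs q (h ∘ suc))

-- Centres are not adjacent to centres, so the first two entries of `allFin` drop out by
-- computation; on the leaves `isLeaf` reduces to `ownLeaf`.
deg-twoStars₁ : (ls : List (Bool × ℕ)) (l : ℕ) → deg (twoStars ls) zero l ≡ count (ownLeaf true l) ls
deg-twoStars₁ ls l = count-tabulate-lookup (ownLeaf true l) ls (isLeaf (twoStars ls) zero l) λ _ → refl

deg-twoStars₂ : (ls : List (Bool × ℕ)) (l : ℕ) → deg (twoStars ls) (suc zero) l ≡ count (ownLeaf false l) ls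
deg-twoStars₂ ls l = count-tabulate-lookup (ownLeaf false l) ls (isLeaf (twoStars ls) (suc zero) l) λ _ → refl

weight-cong : {d e : ℕ → ℕ} → d ≗ e → weight d ≗ weight e
weight-cong d≗e ls = cong product (map-cong d≗e ls)

hom-twoStars : (ls : List (Bool × ℕ)) (ks : List ℕ) →
  hom (star ks) (twoStars ls) ≡ weight (λ l → count (ownLeaf true l) ls) ks
                              + (weight (λ l → count (ownLeaf false l) ls) ks + 0)
hom-twoStars ls ks = begin
  hom (star ks) (twoStars ls)
    ≡⟨ hom-star (twoStars ls) ks ⟩
  starSum (map (deg (twoStars ls)) (centres (twoStars ls))) ks
    ≡⟨ cong (λ vs → starSum (map (deg (twoStars ls)) vs) ks) (centres-twoStars ls) ⟩
  weight (deg (twoStars ls) zero) ks + (weight (deg (twoStars ls) (suc zero)) ks + 0)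
    ≡⟨ cong₂ (λ s t → s + (t + 0)) (weight-cong (deg-twoStars₁ ls) ks) (weight-cong (deg-twoStars₂ ls) ks) ⟩
  weight (λ l → count (ownLeaf true l) ls) ks + (weight (λ l → count (ownLeaf false l) ls) ks + 0) ∎
  where open ≡-Reasoning

-- The stars of the reduction and the instance for a, b, c

-- The markers of p and q are the leaves 3 and 4; the degrees (a, x, 1) and
-- (b, 1, y) refer to the leaves 0, 1, 2.
shapes : List (List ℕ)
shapes = (3 ∷ 0 ∷ []) ∷ (4 ∷ 0 ∷ []) ∷ (0 ∷ 1 ∷ 1 ∷ 2 ∷ [])
       ∷ [] ∷ (3 ∷ []) ∷ (4 ∷ []) ∷ (3 ∷ 4 ∷ []) ∷ (3 ∷ 2 ∷ []) ∷ (4 ∷ 1 ∷ []) ∷ []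

stars : List CGraph
stars = map star shapes

-- In order: there are two centres; each marker occurs once in total; no centre carries both
-- markers; the centre with marker 3 has degree 1 into leaf 2, and the centre with marker 4 has
-- degree 1 into leaf 1.
constantPart : HomRecInstance stars
constantPart = (# 3 , 2) ∷ (# 4 , 1) ∷ (# 5 , 1) ∷ (# 6 , 0) ∷ (# 7 , 1) ∷ (# 8 , 1) ∷ []

-- The three variable counts come last and in the order of the input, so that the encoding arises
-- from those of `a`, `b`, `c` by inserting a fixed word before each.
inst : ℕ → ℕ → ℕ → HomRecInstance stars
inst a b c = constantPart ++ (# 0 , a) ∷ (# 1 , b) ∷ (# 2 , c) ∷ []

degrees₁ degrees₂ : ℕ → ℕ → ℕ → ℕ
degrees₁ a x 0 = a
degrees₁ a x 1 = x
degrees₁ a x 2 = 1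
degrees₁ a x 3 = 1
degrees₁ a x _ = 0
degrees₂ b y 0 = b
degrees₂ b y 1 = 1
degrees₂ b y 2 = y
degrees₂ b y 4 = 1
degrees₂ b y _ = 0

-- The four leading leaves supply the markers and the two degrees prescribed to be 1.
leaves : ℕ → ℕ → ℕ → ℕ → List (Bool × ℕ)
leaves a b x y = (true , 3) ∷ (true , 2) ∷ (false , 4) ∷ (false , 1) ∷ []
              ++ replicate a (true , 0) ++ replicate x (true , 1)
              ++ replicate b (false , 0) ++ replicate y (false , 2)

module _ (a b x y : ℕ) where

  count-leaves : (p : Bool × ℕ → Bool) → count p (leaves a b x y) ≡
    count p ((true , 3) ∷ (true , 2) ∷ (false , 4) ∷ (false , 1) ∷ []) +
    ((if p (true , 0) then a else 0) + ((if p (true , 1) then x else 0) +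
    ((if p (false , 0) then b else 0) + (if p (false , 2) then y else 0))))
  count-leaves p
    rewrite count-++ p ((true , 3) ∷ (true , 2) ∷ (false , 4) ∷ (false , 1) ∷ [])
              (replicate a (true , 0) ++ replicate x (true , 1) ++ replicate b (false , 0) ++ replicate y (false , 2))
          | count-++ p (replicate a (true , 0)) (replicate x (true , 1) ++ replicate b (false , 0) ++ replicate y (false , 2))
          | count-++ p (replicate x (true , 1)) (replicate b (false , 0) ++ replicate y (false , 2))
          | count-++ p (replicate b (false , 0)) (replicate y (false , 2))
          | count-replicate p a (true , 0) | count-replicate p x (true , 1)
          | count-replicate p b (false , 0) | count-replicate p y (false , 2) = refl

  leaves-degrees₁ : (λ l → count (ownLeaf true l) (leaves a b x y)) ≗ degrees₁ a x
  leaves-degrees₁ 0 = trans (count-leaves (ownLeaf true 0)) (+-identityʳ a)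
  leaves-degrees₁ 1 = trans (count-leaves (ownLeaf true 1)) (+-identityʳ x)
  leaves-degrees₁ 2 = count-leaves (ownLeaf true 2)
  leaves-degrees₁ 3 = count-leaves (ownLeaf true 3)
  leaves-degrees₁ 4 = count-leaves (ownLeaf true 4)
  leaves-degrees₁ l@(suc (suc (suc (suc (suc _))))) = count-leaves (ownLeaf true l)

  leaves-degrees₂ : (λ l → count (ownLeaf false l) (leaves a b x y)) ≗ degrees₂ b y
  leaves-degrees₂ 0 = trans (count-leaves (ownLeaf false 0)) (+-identityʳ b)
  leaves-degrees₂ 1 = count-leaves (ownLeaf false 1)
  leaves-degrees₂ 2 = count-leaves (ownLeaf false 2)
  leaves-degrees₂ 3 = count-leaves (ownLeaf false 3)
  leaves-degrees₂ 4 = count-leaves (ownLeaf false 4)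
  leaves-degrees₂ l@(suc (suc (suc (suc (suc _))))) = count-leaves (ownLeaf false l)

  hom-leaves : (ks : List ℕ) → hom (star ks) (twoStars (leaves a b x y))
                             ≡ starSum (degrees₁ a x ∷ degrees₂ b y ∷ []) ks
  hom-leaves ks = trans (hom-twoStars (leaves a b x y) ks)
    (cong₂ (λ s t → s + (t + 0)) (weight-cong leaves-degrees₁ ks) (weight-cong leaves-degrees₂ ks))

realise : (a b c : ℕ) → QPolyYes a b c → HomRecYes stars (inst a b c)
realise a b c (x , y , eq) = twoStars (leaves a b x y) ,
  -- These six sums evaluate by computation: the free degrees `x` and `y` occur in them only behind
  -- a factor 0.
  h [] ∷ h (3 ∷ []) ∷ h (4 ∷ []) ∷ h (3 ∷ 4 ∷ []) ∷ h (3 ∷ 2 ∷ []) ∷ h (4 ∷ 1 ∷ [])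
  ∷ trans (h (3 ∷ 0 ∷ [])) (solve 1 (λ a → con 1 :* (a :* con 1) :+ con 0 := a) refl a)
  ∷ trans (h (4 ∷ 0 ∷ [])) (solve 1 (λ b → con 1 :* (b :* con 1) :+ con 0 := b) refl b)
  ∷ trans (h (0 ∷ 1 ∷ 1 ∷ 2 ∷ [])) (trans (solve 4
      (λ a b x y → a :* (x :* (x :* con 1)) :+ (b :* (con 1 :* (con 1 :* (y :* con 1))) :+ con 0)
                 := a :* (x :* x) :+ b :* y) refl a b x y) eq)
  ∷ []
  where
  h = hom-leaves a b x y
  open +-*-Solver

-- Recovering a solution from the star counts

Constraints : List (ℕ → ℕ) → ℕ → ℕ → ℕ → Set
Constraints ds a b c = All (λ (i , k) → starSum ds (lookup shapes i) ≡ k) (inst a b c)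

-- The first centre carries marker 3, hence the second one carries marker 4.
solve-marked : (d e : ℕ → ℕ) (a b c : ℕ) → Constraints (d ∷ e ∷ []) a b c →
               d 3 ≡ 1 → e 3 ≡ 0 → QPolyYes a b c
solve-marked d e a b c (_ ∷ _ ∷ m₄ ∷ m₃₄ ∷ m₃d₂ ∷ m₄e₁ ∷ eqa ∷ eqb ∷ eqc ∷ []) d₃ e₃ =
  -- The two degrees that the constant part leaves free supply `x` and `y`.
  d 1 , e 2 ,
  arithmetic (d 0) (d 1) (d 2) (d 3) (d 4) (e 0) (e 1) (e 2) (e 3) (e 4) d₃ e₃ m₃₄ m₄ m₃d₂ m₄e₁ eqa eqb eqc
  where
  open +-*-Solver
  plain : ∀ t → t * 1 + 0 ≡ t
  plain = solve 1 (λ t → t :* con 1 :+ con 0 := t) refl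

  single : ∀ t → 1 * (t * 1) + 0 ≡ t
  single = solve 1 (λ t → con 1 :* (t :* con 1) :+ con 0 := t) refl

  -- The degrees are generalised to variables so that each equation, once simplified, can be
  -- substituted by matching on `refl`.
  arithmetic : (d₀ d₁ d₂ d₃ d₄ e₀ e₁ e₂ e₃ e₄ : ℕ) → d₃ ≡ 1 → e₃ ≡ 0 →
    d₃ * (d₄ * 1) + (e₃ * (e₄ * 1) + 0) ≡ 0 → d₄ * 1 + (e₄ * 1 + 0) ≡ 1 →
    d₃ * (d₂ * 1) + (e₃ * (e₂ * 1) + 0) ≡ 1 → d₄ * (d₁ * 1) + (e₄ * (e₁ * 1) + 0) ≡ 1 →
    d₃ * (d₀ * 1) + (e₃ * (e₀ * 1) + 0) ≡ a → d₄ * (d₀ * 1) + (e₄ * (e₀ * 1) + 0) ≡ b →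
    d₀ * (d₁ * (d₁ * (d₂ * 1))) + (e₀ * (e₁ * (e₁ * (e₂ * 1))) + 0) ≡ c →
    a * (d₁ * d₁) + b * e₂ ≡ c
  arithmetic d₀ d₁ d₂ .1 d₄ e₀ e₁ e₂ .0 e₄ refl refl m₃₄ m₄ m₃d₂ m₄e₁ eqa eqb eqc
    -- No centre carries both markers, so `d₄` is 0, and the total for marker 4 makes `e₄` equal to
    -- 1. Each equation for a star with a marker then keeps only one centre and determines `d₂`,
    -- `e₁`, `d₀`, `e₀` in turn.
    with refl ← trans (sym (single d₄)) m₃₄
    with refl ← trans (sym (plain e₄)) m₄
    with refl ← trans (sym (single d₂)) m₃d₂
    with refl ← trans (sym (single e₁)) m₄e₁
    with refl ← trans (sym (single d₀)) eqa
    with refl ← trans (sym (single e₀)) eqb = trans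
      (solve 4 (λ d₀ d₁ e₀ e₂ → d₀ :* (d₁ :* d₁) :+ e₀ :* e₂ :=
                                d₀ :* (d₁ :* (d₁ :* con 1)) :+ (e₀ :* (con 1 :* (con 1 :* (e₂ :* con 1))) :+ con 0))
               refl d₀ d₁ e₀ e₂) eqc

Constraints-swap : (d e : ℕ → ℕ) (a b c : ℕ) → Constraints (d ∷ e ∷ []) a b c → Constraints (e ∷ d ∷ []) a b c
Constraints-swap d e a b c = All.map λ {(i , _)} → trans (swap (weight e (lookup shapes i)) (weight d (lookup shapes i)))
  where
  open +-*-Solver
  swap : ∀ s t → s + (t + 0) ≡ t + (s + 0)
  swap = solve 2 (λ s t → s :+ (t :+ con 0) := t :+ (s :+ con 0)) refl

-- The star without leaves counts the centres, which excludes every length but two. The total 1 for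
-- marker 3 places it at exactly one centre, and by symmetry this may be taken as the first.
solve-constraints : (ds : List (ℕ → ℕ)) (a b c : ℕ) → Constraints ds a b c → QPolyYes a b c
solve-constraints (d ∷ e ∷ []) a b c k@(_ ∷ m₃ ∷ _) = byMarker (d 3) (e 3) refl refl m₃
  where
  byMarker : ∀ s t → d 3 ≡ s → e 3 ≡ t → s * 1 + (t * 1 + 0) ≡ 1 → QPolyYes a b c
  byMarker 1 0 d₃ e₃ _ = solve-marked d e a b c k d₃ e₃
  byMarker 0 1 d₃ e₃ _ = solve-marked e d a b c (Constraints-swap d e a b c k) e₃ d₃
  byMarker 0 0             _ _ ()
  byMarker 0 (suc (suc _)) _ _ ()
  byMarker 1 (suc _)       _ _ ()
  byMarker (suc (suc _)) _ _ _ ()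
solve-constraints []                  a b c (() ∷ _)
solve-constraints (_ ∷ [])            a b c (() ∷ _)
solve-constraints (_ ∷ _ ∷ _ ∷ _)     a b c (() ∷ _)

extract : (a b c : ℕ) → HomRecYes stars (inst a b c) → QPolyYes a b c
extract a b c (G , h₀ ∷ h₁ ∷ h₂ ∷ h₃ ∷ h₄ ∷ h₅ ∷ h₆ ∷ h₇ ∷ h₈ ∷ []) =
  solve-constraints (map (deg G) (centres G)) a b c
    (k (# 3) h₀ ∷ k (# 4) h₁ ∷ k (# 5) h₂ ∷ k (# 6) h₃ ∷ k (# 7) h₄ ∷ k (# 8) h₅
      ∷ k (# 0) h₆ ∷ k (# 1) h₇ ∷ k (# 2) h₈ ∷ [])
  where
  k : ∀ i {t} → hom (star (lookup shapes i)) G ≡ t → starSum (map (deg G) (centres G)) (lookup shapes i) ≡ t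
  k i = trans (sym (hom-star G (lookup shapes i)))

-- Unique readability of the encodings

-- In bijective base two every bit word is a numeral, so a word that passes the syntactic check
-- always encodes numbers.
digits : (d : Word) → Σ ℕ λ x → binDigits (toBin x) ≡ d
digits d = toℕᵇ (number d) , trans (cong binDigits (fromℕ-toℕ (number d))) (binDigits-number d)
  where
  number : Word → ℕᵇ
  number []          = zeroᵇ
  number (true  ∷ d) = 2[1+ number d ]
  number (false ∷ d) = 1+[2 number d ]

  binDigits-number : ∀ d → binDigits (number d) ≡ d
  binDigits-number []          = refl
  binDigits-number (true  ∷ d) = cong (true ∷_) (binDigits-number d)
  binDigits-number (false ∷ d) = cong (false ∷_) (binDigits-number d)

binDigits-injective : ∀ x y → binDigits x ≡ binDigits y → x ≡ y
binDigits-injective zeroᵇ    zeroᵇ    _  = refl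
binDigits-injective 2[1+ x ] 2[1+ y ] eq = cong 2[1+_] (binDigits-injective x y (∷-injectiveʳ eq))
binDigits-injective 1+[2 x ] 1+[2 y ] eq = cong 1+[2_] (binDigits-injective x y (∷-injectiveʳ eq))

-- Digits are doubled while the terminator is an unequal pair, so reading in pairs shows where the
-- code word ends.
selfDelim-prefix : ∀ d e {u v} → selfDelim d ++ u ≡ selfDelim e ++ v → d ≡ e × u ≡ v
selfDelim-prefix []          []          refl = refl , refl
selfDelim-prefix []          (false ∷ e) ()
selfDelim-prefix []          (true ∷ e)  ()
selfDelim-prefix (false ∷ d) []          ()
selfDelim-prefix (true ∷ d)  []          ()
selfDelim-prefix (b ∷ d)     (b′ ∷ e)    eq
  with refl ← ∷-injectiveˡ eq
  with refl , u≡v ← selfDelim-prefix d e (∷-injectiveʳ (∷-injectiveʳ eq)) = refl , u≡v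

encℕ-prefix : ∀ x y {u v} → encℕ x ++ u ≡ encℕ y ++ v → x ≡ y × u ≡ v
encℕ-prefix x y eq with d≡e , u≡v ← selfDelim-prefix (binDigits (toBin x)) (binDigits (toBin y)) eq =
  fromℕ-injective (binDigits-injective _ _ d≡e) , u≡v

selfDelim-long : ∀ d {u} → Σ Bool λ b → Σ Bool λ b′ → Σ Word λ v → selfDelim d ++ u ≡ b ∷ b′ ∷ v
selfDelim-long []      = _ , _ , _ , refl
selfDelim-long (b ∷ d) = _ , _ , _ , refl

module _ (𝓕 : List CGraph) where

  encHomRec-∷ : ∀ i h I → encHomRec 𝓕 ((i , h) ∷ I) ≡ encℕ (toℕ i) ++ encℕ h ++ encHomRec 𝓕 I
  encHomRec-∷ i h I = ++-assoc (encℕ (toℕ i)) (encℕ h) _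

  encHomRec-∷-long : ∀ p I → Σ Bool λ b → Σ Bool λ b′ → Σ Word λ v → encHomRec 𝓕 (p ∷ I) ≡ b ∷ b′ ∷ v
  encHomRec-∷-long (i , h) I with b , b′ , v , eq ← selfDelim-long (binDigits (toBin (toℕ i))) =
    b , b′ , v , trans (encHomRec-∷ i h I) eq

  -- `HomRec` only provides some instance with the given encoding; this identifies it with the one
  -- built by the reduction.
  encHomRec-injective : ∀ I J → encHomRec 𝓕 I ≡ encHomRec 𝓕 J → I ≡ J
  encHomRec-injective []      []      _  = refl
  encHomRec-injective []      (q ∷ J) eq with _ , _ , _ , long ← encHomRec-∷-long q J with () ← trans eq long
  encHomRec-injective (p ∷ I) []      eq with _ , _ , _ , long ← encHomRec-∷-long p I with () ← trans (sym eq) long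
  encHomRec-injective ((i , h) ∷ I) ((j , k) ∷ J) eq
    with i≡j , eq₁ ← encℕ-prefix (toℕ i) (toℕ j)
                       (trans (sym (encHomRec-∷ i h I)) (trans eq (encHomRec-∷ j k J)))
    with refl , eq₂ ← encℕ-prefix h k eq₁ =
    cong₂ _∷_ (cong (_, h) (toℕ-injective i≡j)) (encHomRec-injective I J eq₂)

  -- The empty instance has the empty encoding, and any other begins with a code word of at least
  -- two bits. A one-bit word can thus serve as a no-instance.
  encHomRec-not-single : ∀ I b → encHomRec 𝓕 I ≢ b ∷ []
  encHomRec-not-single (p ∷ I) b eq with _ , _ , _ , long ← encHomRec-∷-long p I with () ← trans (sym eq) long

-- Turing machines whose states form a finite type

-- A coding with a decoder that undoes it: the machine stores coded states and decodes them before
-- acting, so the coding need not be onto.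
Finite : Set → Set
Finite A = Σ ℕ λ k → A ↪ Fin k

finite-× : {A B : Set} → Finite A → Finite B → Finite (A × B)
finite-× (_ , f) (_ , g) = _ , ↔⇒↪ (↔-sym *↔×) ↪-∘ (f ×-↪ g)

finite-⊎ : {A B : Set} → Finite A → Finite B → Finite (A ⊎ B)
finite-⊎ (_ , f) (_ , g) = _ , ↔⇒↪ (↔-sym +↔⊎) ↪-∘ (f ⊎-↪ g)

finite-Bool : Finite Bool
finite-Bool = 2 , ↔⇒↪ (↔-sym 2↔Bool)

finite-retract : {A B : Set} (f : A → B) (g : B → A) → (∀ x → g (f x) ≡ x) → Finite B → Finite A
finite-retract f g gf (k , e) = k , e ↪-∘ mk↪ {to = f} {from = g} λ { refl → gf _ }

Cell : Set
Cell = Maybe Bool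

symbol : Cell → Fin 3
symbol nothing      = zero
symbol (just false) = suc zero
symbol (just true)  = suc (suc zero)

cell : Fin 3 → Cell
cell zero             = nothing
cell (suc zero)       = just false
cell (suc (suc zero)) = just true

cell-symbol : ∀ x → cell (symbol x) ≡ x
cell-symbol nothing      = refl
cell-symbol (just false) = refl
cell-symbol (just true)  = refl

finite-Cell : Finite Cell
finite-Cell = 3 , mk↪ {to = symbol} {from = cell} λ { refl → cell-symbol _ }

finite-Vec : {A : Set} → Finite A → (k : ℕ) → Finite (Vec A k)
finite-Vec f zero    = 1 , mk↪ {to = λ _ → zero} {from = λ _ → []} λ { {[]} _ → refl }
finite-Vec f (suc k) = finite-retract (λ { (x ∷ xs) → x , xs }) (λ (x , xs) → x ∷ xs) (λ { (x ∷ xs) → refl })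
                                      (finite-× f (finite-Vec f k))

first : List Cell → Cell
first []      = nothing
first (x ∷ _) = x

run-+ : (M : TM) (s t : ℕ) (C : Config M) → run M (s + t) C ≡ run M t (run M s C)
run-+ M zero    t C = refl
run-+ M (suc s) t C = run-+ M s t (step M C)

bits : Word → List Cell
bits = map just

module Machine {State : Set} (finite : Finite State) (start : State)
               (act : State → Cell → Maybe State × Cell × Move) where

  enc = RightInverse.to (proj₂ finite)
  dec = RightInverse.from (proj₂ finite)

  machine : TM
  machine = record
    { Q     = proj₁ finite
    ; Γ     = 0
    ; start = enc start
    ; δ     = λ i h → let (s , x , m) = act (dec i) (cell h) in Maybe.map enc s , symbol x , m
    }

  -- The head is on the first cell of r; beyond the end of a list the tape is blank.
  conf : Maybe State → List Cell → List Cell → Config machine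
  conf s l r = config (Maybe.map enc s) (map symbol l) (symbol (first r)) (map symbol (drop 1 r))

  perform : List Cell → List Cell → Maybe State × Cell × Move → Config machine
  perform l r (s , y , m) = move machine m (map symbol l) (symbol y) (map symbol (drop 1 r)) (Maybe.map enc s)

  step-conf : ∀ {s a} l r → act s (first r) ≡ a → step machine (conf (just s) l r) ≡ perform l r a
  step-conf l r refl = cong (perform l r)
    (cong₂ act (RightInverse.strictlyInverseʳ (proj₂ finite) _) (cell-symbol (first r)))

  step-right : ∀ {s s′ y} l r → act s (first r) ≡ (s′ , y , moveR) →
               step machine (conf (just s) l r) ≡ conf s′ (y ∷ l) (drop 1 r)
  step-right {s′ = s′} {y} l r eq = trans (step-conf l r eq) (moved r)
    where
    moved : ∀ r → perform l r (s′ , y , moveR) ≡ conf s′ (y ∷ l) (drop 1 r)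
    moved []          = refl
    moved (_ ∷ [])    = refl
    moved (_ ∷ _ ∷ _) = refl

  -- A move beyond the left end meets a fresh blank, which is what `first []` returns, so one
  -- formula covers both cases.
  step-left : ∀ {s s′ y} l r → act s (first r) ≡ (s′ , y , moveL) →
              step machine (conf (just s) l r) ≡ conf s′ (drop 1 l) (first l ∷ y ∷ drop 1 r)
  step-left {s′ = s′} {y} l r eq = trans (step-conf l r eq) (moved l)
    where
    moved : ∀ l → perform l r (s′ , y , moveL) ≡ conf s′ (drop 1 l) (first l ∷ y ∷ drop 1 r)
    moved []      = refl
    moved (_ ∷ _) = refl

  step-stay : ∀ {s s′ y} l r → act s (first r) ≡ (s′ , y , stay) →
              step machine (conf (just s) l r) ≡ conf s′ l (y ∷ drop 1 r)
  step-stay = step-conf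

  initial-conf : ∀ w → initial machine w ≡ conf (just start) [] (bits w)
  initial-conf []      = refl
  initial-conf (b ∷ w) = cong₂ (config (just (enc start)) []) (bit b) (bits-symbols w)
    where
    bit : ∀ b → bitSym machine b ≡ symbol (just b)
    bit false = refl
    bit true  = refl

    bits-symbols : ∀ w → map (bitSym machine) w ≡ map symbol (bits w)
    bits-symbols []      = refl
    bits-symbols (b ∷ w) = cong₂ _∷_ (bit b) (bits-symbols w)

  output-conf : ∀ s l w r → output machine (conf s l (bits w ++ nothing ∷ r)) ≡ w
  output-conf s l []      r = refl
  output-conf s l (b ∷ w) r = trans (headBit b) (cong (b ∷_) (rest w))
    where
    R : Word → List (Fin 3)
    R w = map symbol (bits w ++ nothing ∷ r)

    headBit : ∀ b → readBits machine (symbol (just b) ∷ R w) ≡ b ∷ readBits machine (R w)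
    headBit false = refl
    headBit true  = refl

    rest : ∀ w → readBits machine (R w) ≡ w
    rest []          = refl
    rest (false ∷ w) = cong (false ∷_) (rest w)
    rest (true  ∷ w) = cong (true ∷_) (rest w)

-- From 2 on, the power dominates `2 * m`; for 0 and 1 the additive constant `2 + d` suffices.
linear≤poly : ∀ m d → 2 * m + d ≤ m ^ (2 + d) + (2 + d)
linear≤poly zero    d = m≤n+m d _
linear≤poly (suc zero) d = m≤n+m (2 + d) _
linear≤poly m@(suc (suc k)) d = +-mono-≤ (begin
  2 * m            ≡⟨ *-comm 2 m ⟩
  m * 2            ≤⟨ *-monoʳ-≤ m (s≤s (s≤s z≤n)) ⟩
  m * m            ≡⟨ cong (m *_) (*-identityʳ m) ⟨
  m * (m * 1)      ≤⟨ *-monoʳ-≤ m (*-monoʳ-≤ m (m^n>0 m d)) ⟩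
  m ^ (2 + d)      ∎) (m≤n+m d 2)
  where open ≤-Reasoning

-- A one-pass machine that inserts fixed words

-- K₀, K₁ and K₂ are inserted before the first, second and third number.  The
-- machine keeps the pending output in a queue, initially K₀, whose length is
-- fixed by the control state; hence there are finitely many states.
module Insertion (K₀ K₁ K₂ : Word) where

  -- num i p: inside the i-th number, p being the first half of a bit pair.
  data Control : Set where
    num : Fin 3 → Maybe Bool → Control
    end : Control

  -- Each scanning step takes in one cell and emits one, so the queue grows exactly by the inserted
  -- words.
  cap : Control → ℕ
  cap (num zero _)             = length K₀
  cap (num (suc zero) _)       = length K₀ + length K₁
  cap (num (suc (suc zero)) _) = length K₀ + length K₁ + length K₂
  cap end                      = length K₀ + length K₁ + length K₂

  record Transition (c : Control) : Set where
    constructor _⟨_⟩_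
    field
      target   : Control
      inserted : Word
      cap-eq   : cap c + length inserted ≡ cap target

  cap-num : ∀ k p p′ → cap (num k p) + 0 ≡ cap (num k p′)
  cap-num zero             _ _ = +-identityʳ _
  cap-num (suc zero)       _ _ = +-identityʳ _
  cap-num (suc (suc zero)) _ _ = +-identityʳ _

  next : (c : Control) → Bool → Maybe (Transition c)
  next (num k nothing)                     b     = just (num k (just b) ⟨ [] ⟩ cap-num k _ (just b))
  next (num k (just false))                false = just (num k nothing ⟨ [] ⟩ cap-num k _ nothing)
  next (num k (just true))                 true  = just (num k nothing ⟨ [] ⟩ cap-num k _ nothing)
  next (num k (just true))                 false = nothing
  next (num zero             (just false)) true  = just (num (suc zero) nothing ⟨ K₁ ⟩ refl)
  next (num (suc zero)       (just false)) true  = just (num (suc (suc zero)) nothing ⟨ K₂ ⟩ refl)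
  next (num (suc (suc zero)) (just false)) true  = just (end ⟨ [] ⟩ +-identityʳ _)
  next end                                 b     = nothing

  -- The specification of the machine: what the unread input still contributes to the output, behind
  -- the cells already queued.
  parse : Control → Word → Maybe Word
  parse c         (b ∷ w) = maybe′ (λ (c′ ⟨ K ⟩ _) → Maybe.map (λ u → b ∷ K ++ u) (parse c′ w)) nothing (next c b)
  parse end       []      = just []
  parse (num _ _) []      = nothing

  data State : Set where
    scan   : (c : Control) → Vec Cell (cap c) → State
    rewind : State
    reject : State

  Action : Set
  Action = Maybe State × Cell × Move

  enqueue : ∀ {k m} → Vec Cell k → Bool → (K : Word) → k + length K ≡ m → Vec Cell (suc m)
  enqueue q b K eq = Vec.cast (cong suc eq) ((q ∷ʳ just b) Vec.++ Vec.map just (fromList K))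

  toList-enqueue : ∀ {k m} (q : Vec Cell k) b K (eq : k + length K ≡ m) →
                   toList (enqueue q b K eq) ≡ toList q ++ just b ∷ bits K
  toList-enqueue q b K eq = begin
    toList (enqueue q b K eq)
      ≡⟨ toList-cast (cong suc eq) _ ⟩
    toList ((q ∷ʳ just b) Vec.++ Vec.map just (fromList K))
      ≡⟨ toList-++ (q ∷ʳ just b) _ ⟩
    toList (q ∷ʳ just b) ++ toList (Vec.map just (fromList K))
      ≡⟨ cong₂ _++_ (toList-∷ʳ (just b) q) (trans (toList-map just (fromList K)) (cong bits (toList∘fromList K))) ⟩
    (toList q ++ just b ∷ []) ++ bits K
      ≡⟨ ++-assoc (toList q) _ _ ⟩
    toList q ++ just b ∷ bits K ∎
    where open ≡-Reasoning

  shift : (c : Control) → Vec Cell (suc (cap c)) → Action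
  shift c (x ∷ q) = just (scan c q) , x , moveR

  rejection : Action
  rejection = just reject , nothing , moveL

  -- After the end of the input, blanks are pushed until one of them comes out.
  drain : Vec Cell (suc (cap end)) → Action
  drain (nothing ∷ q) = just rewind , nothing , moveL
  drain (just b  ∷ q) = just (scan end q) , just b , moveR

  act : State → Cell → Action
  act (scan c q) (just b) =
    maybe′ (λ (c′ ⟨ K ⟩ eq) → shift c′ (enqueue q b K eq)) rejection (next c b)
  act (scan (num _ _) q) nothing = rejection
  act (scan end q)       nothing = drain (q ∷ʳ nothing)
  act rewind (just b) = just rewind , just b , moveL
  -- The blank before the output has been reached; one move right puts the head on the first bit,
  -- where `output` starts to read.
  act rewind nothing  = nothing , nothing , moveR
  act reject _        = nothing , just true , stay

  -- Unfolding this coding would make conversion checking very slow.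
  abstract
    finite-State : Finite State
    finite-State = finite-retract code state state-code
      (finite-⊎ (number (cap (num zero nothing))) (finite-⊎ (number (cap (num (suc zero) nothing)))
        (finite-⊎ (number (cap end)) (finite-⊎ (finite-Vec finite-Cell (cap end)) finite-Bool))))
      where
      Number : ℕ → Set
      Number k = Cell × Vec Cell k

      number : ∀ k → Finite (Number k)
      number k = finite-× finite-Cell (finite-Vec finite-Cell k)

      Code : Set
      Code = Number (cap (num zero nothing)) ⊎ Number (cap (num (suc zero) nothing)) ⊎ Number (cap end) ⊎ Vec Cell (cap end) ⊎ Bool

      code : State → Code
      code (scan (num zero p) q)             = inj₁ (p , q)
      code (scan (num (suc zero) p) q)       = inj₂ (inj₁ (p , q))
      code (scan (num (suc (suc zero)) p) q) = inj₂ (inj₂ (inj₁ (p , q)))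
      code (scan end q)                      = inj₂ (inj₂ (inj₂ (inj₁ q)))
      code rewind                            = inj₂ (inj₂ (inj₂ (inj₂ false)))
      code reject                            = inj₂ (inj₂ (inj₂ (inj₂ true)))

      state : Code → State
      state (inj₁ (p , q))                       = scan (num zero p) q
      state (inj₂ (inj₁ (p , q)))                = scan (num (suc zero) p) q
      state (inj₂ (inj₂ (inj₁ (p , q))))         = scan (num (suc (suc zero)) p) q
      state (inj₂ (inj₂ (inj₂ (inj₁ q))))        = scan end q
      state (inj₂ (inj₂ (inj₂ (inj₂ false))))    = rewind
      state (inj₂ (inj₂ (inj₂ (inj₂ true))))     = reject

      state-code : ∀ s → state (code s) ≡ s
      state-code (scan (num zero p) q)             = refl
      state-code (scan (num (suc zero) p) q)       = refl
      state-code (scan (num (suc (suc zero)) p) q) = refl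
      state-code (scan end q)                      = refl
      state-code rewind                            = refl
      state-code reject                            = refl

  startQueue : Vec Cell (length K₀)
  startQueue = Vec.map just (fromList K₀)

  start : State
  start = scan (num zero nothing) startQueue

  -- Malformed input is mapped to a one-bit word, which encodes no instance.
  transduce : Word → Word
  transduce w = maybe′ (K₀ ++_) (true ∷ []) (parse (num zero nothing) w)

  -- Runs of the insertion machine and their length

  -- Queued cells and future output together gain one bit per input bit plus the inserted words.
  -- This fixes the length of the output and so the time for rewinding.
  parse-length : ∀ c w {u} → parse c w ≡ just u → cap c + length u ≡ length w + cap end
  parse-length end []      refl = +-identityʳ _
  parse-length c   (b ∷ w) eq with next c b
  ... | just (c′ ⟨ K ⟩ cap-eq) with parse c′ w in eq′
  parse-length c   (b ∷ w) refl | just (c′ ⟨ K ⟩ cap-eq) | just u = begin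
    cap c + suc (length (K ++ u))         ≡⟨ +-suc (cap c) _ ⟩
    suc (cap c + length (K ++ u))         ≡⟨ cong (λ k → suc (cap c + k)) (length-++ K) ⟩
    suc (cap c + (length K + length u))   ≡⟨ cong suc (+-assoc (cap c) _ _) ⟨
    suc (cap c + length K + length u)     ≡⟨ cong (λ k → suc (k + length u)) cap-eq ⟩
    suc (cap c′ + length u)               ≡⟨ cong suc (parse-length c′ w eq′) ⟩
    suc (length w + cap end)              ∎
    where open ≡-Reasoning

  open Machine finite-State start act

  -- Here `l` lists the tape leftwards starting with the cell under the head.
  rewinding : List Cell → List Cell → Config machine
  rewinding l r = conf (just rewind) (drop 1 l) (first l ∷ r)

  drain-blank : (q : Vec Cell (suc (cap end))) {xs : List Cell} → toList q ≡ nothing ∷ xs →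
                drain q ≡ (just rewind , nothing , moveL)
  drain-blank (nothing ∷ q) refl = refl

  drain-bit : (q : Vec Cell (suc (cap end))) {b : Bool} {xs : List Cell} → toList q ≡ just b ∷ xs →
              Σ (Vec Cell (cap end)) λ q′ → drain q ≡ (just (scan end q′) , just b , moveR) × toList q′ ≡ xs
  drain-bit (just b ∷ q) refl = q , refl , refl

  replicate-∷ʳ : ∀ k → replicate k nothing ++ nothing ∷ [] ≡ nothing ∷ replicate {A = Cell} k nothing
  replicate-∷ʳ zero    = refl
  replicate-∷ʳ (suc k) = cong (nothing ∷_) (replicate-∷ʳ k)

  push-blank : ∀ (v : Word) k {m} (q : Vec Cell m) → toList q ≡ bits v ++ replicate k nothing →
               toList (q ∷ʳ nothing) ≡ bits v ++ nothing ∷ replicate k nothing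
  push-blank v k q eq = begin
    toList (q ∷ʳ nothing)                              ≡⟨ toList-∷ʳ nothing q ⟩
    toList q ++ nothing ∷ []                           ≡⟨ cong (_++ nothing ∷ []) eq ⟩
    (bits v ++ replicate k nothing) ++ nothing ∷ []    ≡⟨ ++-assoc (bits v) _ _ ⟩
    bits v ++ replicate k nothing ++ nothing ∷ []      ≡⟨ cong (bits v ++_) (replicate-∷ʳ k) ⟩
    bits v ++ nothing ∷ replicate k nothing            ∎
    where open ≡-Reasoning

  -- The queue keeps its length: it holds the remaining bits `v` followed by the `k` blanks pushed
  -- so far. The first blank to come out shows that all bits are written, and it also delimits the
  -- output on the right.
  run-drain : ∀ v l (q : Vec Cell (cap end)) k → toList q ≡ bits v ++ replicate k nothing →
              run machine (suc (length v)) (conf (just (scan end q)) l []) ≡ rewinding (bits v ʳ++ l) (nothing ∷ [])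
  run-drain []      l q k eq = step-left l [] (drain-blank _ (push-blank [] k q eq))
  run-drain (b ∷ v) l q k eq with q′ , acts , eq′ ← drain-bit _ (push-blank (b ∷ v) k q eq) =
    trans (cong (run machine (suc (length v))) (step-right l [] acts))
          (run-drain v (just b ∷ l) q′ (suc k) eq′)

  uncons : ∀ v b (K : Word) → Σ Bool λ x → Σ Word λ v′ → v ++ b ∷ K ≡ x ∷ v′
  uncons []      b K = b , K , refl
  uncons (x ∷ v) b K = x , v ++ b ∷ K , refl

  shift-bit : ∀ c (q : Vec Cell (suc (cap c))) {b : Bool} {xs : List Cell} → toList q ≡ just b ∷ xs →
              Σ (Vec Cell (cap c)) λ q′ → shift c q ≡ (just (scan c q′) , just b , moveR) × toList q′ ≡ xs
  shift-bit c (x ∷ q) refl = q , refl , refl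

  -- The front of the queue overwrites the cell just read, so the output grows in place behind the
  -- head, reversed in `l`. Still to be written are the queued `v` and then `u`; when the input
  -- ends, `v` fills the queue and draining takes `suc (cap end)` steps.
  run-scan : ∀ c w (q : Vec Cell (cap c)) l v {u} → toList q ≡ bits v → parse c w ≡ just u →
             run machine (length w + suc (cap end)) (conf (just (scan c q)) l (bits w))
               ≡ rewinding (bits (v ++ u) ʳ++ l) (nothing ∷ [])
  run-scan end [] q l v eq refl = begin
    run machine (suc (cap end)) (conf (just (scan end q)) l [])
      ≡⟨ cong (λ k → run machine (suc k) (conf (just (scan end q)) l [])) cap-v ⟩
    run machine (suc (length v)) (conf (just (scan end q)) l [])
      ≡⟨ run-drain v l q 0 (trans eq (sym (++-identityʳ (bits v)))) ⟩
    rewinding (bits v ʳ++ l) (nothing ∷ [])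
      ≡⟨ cong (λ v → rewinding (bits v ʳ++ l) (nothing ∷ [])) (++-identityʳ v) ⟨
    rewinding (bits (v ++ []) ʳ++ l) (nothing ∷ []) ∎
    where
    open ≡-Reasoning
    cap-v : cap end ≡ length v
    cap-v = trans (sym (length-toList q)) (trans (cong length eq) (length-map just v))
  run-scan c (b ∷ w) q l v eq eqp with next c b in eqn
  ... | just (c′ ⟨ K ⟩ cap-eq) with parse c′ w in eq′
  run-scan c (b ∷ w) q l v eq refl | just (c′ ⟨ K ⟩ cap-eq) | just u
    with x , v′ , eqv ← uncons v b K
    with q′ , acts , eqq ← shift-bit c′ (enqueue q b K cap-eq) (trans (toList-enqueue q b K cap-eq)
           (trans (cong (_++ _) eq) (trans (sym (map-++ just v (b ∷ K))) (cong bits eqv)))) = begin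
    run machine (length w + suc (cap end)) (step machine (conf (just (scan c q)) l (bits (b ∷ w))))
      ≡⟨ cong (run machine (length w + suc (cap end))) (step-right l (bits (b ∷ w))
           (trans (cong (maybe′ _ rejection) eqn) acts)) ⟩
    run machine (length w + suc (cap end)) (conf (just (scan c′ q′)) (just x ∷ l) (bits w))
      ≡⟨ run-scan c′ w q′ (just x ∷ l) v′ eqq eq′ ⟩
    rewinding (bits (x ∷ v′ ++ u) ʳ++ l) (nothing ∷ [])
      ≡⟨ cong (λ v → rewinding (bits v ʳ++ l) (nothing ∷ []))
              (trans (cong (_++ u) (sym eqv)) (++-assoc v (b ∷ K) u)) ⟩
    rewinding (bits (v ++ b ∷ K ++ u) ʳ++ l) (nothing ∷ []) ∎
    where open ≡-Reasoning

  -- Each step left carries one bit over to the right-hand list; past the last bit `first []`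
  -- supplies the blank that stops the walk.
  run-rewind : ∀ v r → run machine (suc (length v)) (rewinding (bits v) r) ≡ conf nothing (nothing ∷ []) (bits v ʳ++ r)
  run-rewind []      r = step-right [] (nothing ∷ r) refl
  run-rewind (b ∷ v) r = trans (cong (run machine (suc (length v))) (step-left (bits v) (just b ∷ r) refl))
                               (run-rewind v (just b ∷ r))

  -- The blank written before the move left delimits the single bit that is written next.
  run-rejection : ∀ {s} l r → act s (first r) ≡ rejection →
                  run machine 2 (conf (just s) l r) ≡ conf nothing (drop 1 l) (just true ∷ nothing ∷ drop 1 r)
  run-rejection l r eq = trans (cong (step machine) (step-left l r eq))
                               (step-stay (drop 1 l) (first l ∷ nothing ∷ drop 1 r) refl)

  run-reject : ∀ c w (q : Vec Cell (cap c)) l → parse c w ≡ nothing →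
               Σ ℕ λ t → t ≤ length w + 2 × Σ (List Cell) λ l′ → Σ (List Cell) λ r →
               run machine t (conf (just (scan c q)) l (bits w)) ≡ conf nothing l′ (just true ∷ nothing ∷ r)
  run-reject (num _ _) [] q l eq = 2 , ≤-refl , _ , _ , run-rejection l [] refl
  run-reject c (b ∷ w) q l eq with next c b in eqn
  ... | nothing = 2 , m≤n+m 2 (suc (length w)) , _ , _ , run-rejection l (bits (b ∷ w)) (cong (maybe′ _ rejection) eqn)
  ... | just (c′ ⟨ K ⟩ cap-eq) with parse c′ w in eq′
  ...   | nothing
    with enqueue q b K cap-eq in eqe
  ...     | x ∷ q′
    with t , t≤ , l′ , r , runs ← run-reject c′ w q′ (x ∷ l) eq′ =
      suc t , s≤s t≤ , l′ , r ,
      trans (cong (run machine t) (step-right l (bits (b ∷ w))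
              (trans (cong (maybe′ _ rejection) eqn) (cong (shift c′) eqe)))) runs

  run-accept : ∀ w {u} → parse (num zero nothing) w ≡ just u →
               run machine ((length w + suc (cap end)) + suc (length (K₀ ++ u))) (initial machine w)
                 ≡ conf nothing (nothing ∷ []) (bits (K₀ ++ u) ++ nothing ∷ [])
  run-accept w {u} eq = begin
    run machine (T + suc (length out)) (initial machine w)
      ≡⟨ run-+ machine T _ (initial machine w) ⟩
    run machine (suc (length out)) (run machine T (initial machine w))
      ≡⟨ cong (λ C → run machine (suc (length out)) (run machine T C)) (initial-conf w) ⟩
    run machine (suc (length out)) (run machine T (conf (just start) [] (bits w)))
      ≡⟨ cong (run machine (suc (length out))) (run-scan (num zero nothing) w startQueue [] K₀
           (trans (toList-map just (fromList K₀)) (cong bits (toList∘fromList K₀))) eq) ⟩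
    run machine (suc (length out)) (rewinding (bits out ʳ++ []) (nothing ∷ []))
      ≡⟨ cong₂ (λ k l → run machine (suc k) (rewinding l (nothing ∷ [])))
           (sym (trans (length-ʳ++ out) (+-identityʳ _))) (sym (map-ʳ++ just out)) ⟩
    run machine (suc (length (out ʳ++ []))) (rewinding (bits (out ʳ++ [])) (nothing ∷ []))
      ≡⟨ run-rewind (out ʳ++ []) (nothing ∷ []) ⟩
    conf nothing (nothing ∷ []) (bits (out ʳ++ []) ʳ++ (nothing ∷ []))
      -- The reversal by scanning and the reversal by rewinding cancel.
      ≡⟨ cong (conf nothing (nothing ∷ [])) (trans (cong (_ʳ++ _) (map-ʳ++ just out)) (ʳ++-ʳ++ (bits out))) ⟩
    conf nothing (nothing ∷ []) (bits out ++ nothing ∷ []) ∎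
    where
    open ≡-Reasoning
    T   = length w + suc (cap end)
    out = K₀ ++ u

  -- An accepting run passes over the `length w + cap end` cells of the output twice, with one
  -- turning step at each end; a rejecting run takes at most `length w + 2` steps.
  computes : ∀ w → Σ ℕ λ t → t ≤ 2 * length w + (2 + 2 * cap end) ×
             halted machine (run machine t (initial machine w)) ×
             output machine (run machine t (initial machine w)) ≡ transduce w
  computes w with parse (num zero nothing) w in eq
  ... | just u = _ , ≤-reflexive time , cong Config.state runs ,
                 trans (cong (output machine) runs) (output-conf nothing (nothing ∷ []) (K₀ ++ u) [])
    where
    runs = run-accept w eq
    open +-*-Solver
    time : length w + suc (cap end) + suc (length (K₀ ++ u)) ≡ 2 * length w + (2 + 2 * cap end)
    time = trans (cong (λ k → length w + suc (cap end) + suc k) (trans (length-++ K₀) (parse-length _ w eq)))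
      (solve 2 (λ m k → m :+ (con 1 :+ k) :+ (con 1 :+ (m :+ k)) := con 2 :* m :+ (con 2 :+ con 2 :* k))
             refl (length w) (cap end))
  ... | nothing with t , t≤ , l , r , runs′ ← run-reject (num zero nothing) w startQueue [] eq =
    t , ≤-trans t≤ (+-mono-≤ (m≤m+n _ _) (m≤m+n 2 _)) , cong Config.state runs ,
    trans (cong (output machine) runs) (output-conf nothing l (true ∷ []) r)
    where
    runs : run machine t (initial machine w) ≡ conf nothing l (just true ∷ nothing ∷ r)
    runs = trans (cong (run machine t) (initial-conf w)) runs′

  transduce-polyTime : PolyTimeComputable transduce
  transduce-polyTime = machine , 2 + (2 + 2 * cap end) , λ w →
    let (t , t≤ , halts , out) = computes w in t , ≤-trans t≤ (linear≤poly (length w) (2 + 2 * cap end)) , halts , out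

  -- Accepted words and encoded triples

  following : Fin 3 → Control
  following zero             = num (suc zero) nothing
  following (suc zero)       = num (suc (suc zero)) nothing
  following (suc (suc zero)) = end

  insertion : Fin 3 → Word
  insertion zero             = K₁
  insertion (suc zero)       = K₂
  insertion (suc (suc zero)) = []

  parse-selfDelim : ∀ k d w → parse (num k nothing) (selfDelim d ++ w)
                            ≡ Maybe.map (λ u → selfDelim d ++ insertion k ++ u) (parse (following k) w)
  parse-selfDelim zero             [] w = sym (map-∘ (parse _ w))
  parse-selfDelim (suc zero)       [] w = sym (map-∘ (parse _ w))
  parse-selfDelim (suc (suc zero)) [] w = sym (map-∘ (parse _ w))
  parse-selfDelim k (false ∷ d) w rewrite parse-selfDelim k d w with parse (following k) w
  ... | just _  = refl
  ... | nothing = refl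
  parse-selfDelim k (true ∷ d) w rewrite parse-selfDelim k d w with parse (following k) w
  ... | just _  = refl
  ... | nothing = refl

  just⁻ : ∀ {f : Word → Word} {m u} → Maybe.map f m ≡ just u → Σ Word λ v → m ≡ just v
  just⁻ {m = just v} _ = v , refl

  -- The input is read back in pairs: equal pairs extend `d`, the pair `false`, `true` closes it,
  -- and everything else fails to parse.
  parse-selfDelim⁻ : ∀ k w {u} → parse (num k nothing) w ≡ just u →
                       Σ Word λ d → Σ Word λ w′ → Σ Word λ u′ → w ≡ selfDelim d ++ w′ × parse (following k) w′ ≡ just u′
  parse-selfDelim⁻ k (false ∷ false ∷ w) eq
    with _ , eq₁ ← just⁻ eq with _ , eq₂ ← just⁻ eq₁
    with d , w′ , u′ , refl , eq′ ← parse-selfDelim⁻ k w eq₂ = false ∷ d , w′ , u′ , refl , eq′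
  parse-selfDelim⁻ k (true ∷ true ∷ w) eq
    with _ , eq₁ ← just⁻ eq with _ , eq₂ ← just⁻ eq₁
    with d , w′ , u′ , refl , eq′ ← parse-selfDelim⁻ k w eq₂ = true ∷ d , w′ , u′ , refl , eq′
  parse-selfDelim⁻ zero (false ∷ true ∷ w) eq
    with _ , eq₁ ← just⁻ eq with u′ , eq₂ ← just⁻ eq₁ = [] , w , u′ , refl , eq₂
  parse-selfDelim⁻ (suc zero) (false ∷ true ∷ w) eq
    with _ , eq₁ ← just⁻ eq with u′ , eq₂ ← just⁻ eq₁ = [] , w , u′ , refl , eq₂
  parse-selfDelim⁻ (suc (suc zero)) (false ∷ true ∷ w) eq
    with _ , eq₁ ← just⁻ eq with u′ , eq₂ ← just⁻ eq₁ = [] , w , u′ , refl , eq₂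
  parse-selfDelim⁻ k (true ∷ false ∷ w) ()
  parse-selfDelim⁻ k (b ∷ []) ()

  parse-number⁻ : ∀ k w {u} → parse (num k nothing) w ≡ just u →
                  Σ ℕ λ x → Σ Word λ w′ → Σ Word λ u′ → w ≡ encℕ x ++ w′ × parse (following k) w′ ≡ just u′
  parse-number⁻ k w eq with d , w′ , u′ , split , eq′ ← parse-selfDelim⁻ k w eq with x , refl ← digits d =
    x , w′ , u′ , split , eq′

  parse-encQPoly⁻ : ∀ w {u} → parse (num zero nothing) w ≡ just u →
                    Σ ℕ λ a → Σ ℕ λ b → Σ ℕ λ c → encQPoly a b c ≡ w
  parse-encQPoly⁻ w eq
    with a , w₁ , _ , refl , eq₁ ← parse-number⁻ zero w eq
    with b , w₂ , _ , refl , eq₂ ← parse-number⁻ (suc zero) w₁ eq₁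
    -- In control `end` only the empty word parses, which forces the remainder to be `[]`.
    with c , [] , _ , refl , eq₃ ← parse-number⁻ (suc (suc zero)) w₂ eq₂ =
    a , b , c , cong (λ v → encℕ a ++ encℕ b ++ v) (sym (++-identityʳ (encℕ c)))

  transduce-encQPoly : ∀ a b c → transduce (encQPoly a b c)
                               ≡ K₀ ++ encℕ a ++ K₁ ++ encℕ b ++ K₂ ++ encℕ c ++ []
  transduce-encQPoly a b c = cong (maybe′ (K₀ ++_) (true ∷ [])) (begin
    parse (num zero nothing) (encℕ a ++ encℕ b ++ encℕ c)
      ≡⟨ parse-selfDelim zero (binDigits (toBin a)) _ ⟩
    Maybe.map afterA (parse (num (suc zero) nothing) (encℕ b ++ encℕ c))
      ≡⟨ cong (Maybe.map afterA) (parse-selfDelim (suc zero) (binDigits (toBin b)) _) ⟩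
    Maybe.map afterA (Maybe.map afterB (parse (num (suc (suc zero)) nothing) (encℕ c)))
      ≡⟨ cong (λ v → Maybe.map afterA (Maybe.map afterB (parse (num (suc (suc zero)) nothing) v))) (++-identityʳ (encℕ c)) ⟨
    Maybe.map afterA (Maybe.map afterB (parse (num (suc (suc zero)) nothing) (encℕ c ++ [])))
      ≡⟨ cong (Maybe.map afterA ∘ Maybe.map afterB) (parse-selfDelim (suc (suc zero)) (binDigits (toBin c)) []) ⟩
    just (encℕ a ++ K₁ ++ encℕ b ++ K₂ ++ encℕ c ++ []) ∎)
    where
    open ≡-Reasoning
    afterA afterB : Word → Word
    afterA u = encℕ a ++ K₁ ++ u
    afterB u = encℕ b ++ K₂ ++ u

  transduce-cases : ∀ w → (Σ ℕ λ a → Σ ℕ λ b → Σ ℕ λ c → encQPoly a b c ≡ w) ⊎ transduce w ≡ true ∷ []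
  transduce-cases w with parse (num zero nothing) w in eq
  ... | just _  = inj₁ (parse-encQPoly⁻ w eq)
  ... | nothing = inj₂ refl

-- The reduction

open Insertion (encHomRec stars constantPart ++ encℕ 0) (encℕ 1) (encℕ 2)
  using (transduce; transduce-polyTime; transduce-encQPoly; transduce-cases)

-- The inserted words are closed bit lists, so reassociating `++` across them is computation; the
-- trailing `[]` is the end of `concat`.
encHomRec-inst : ∀ a b c → encHomRec stars (inst a b c) ≡ transduce (encQPoly a b c)
encHomRec-inst a b c = sym (transduce-encQPoly a b c)

QPoly⇔HomRec : ∀ w → QPoly w ⇔ HomRec stars (transduce w)
QPoly⇔HomRec w = mk⇔ forward backward
  where
  forward : QPoly w → HomRec stars (transduce w)
  forward (a , b , c , refl , yes) = inst a b c , encHomRec-inst a b c , realise a b c yes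

  backward : HomRec stars (transduce w) → QPoly w
  backward (I , eq , yes) with transduce-cases w
  ... | inj₂ rejected = contradiction (trans eq rejected) (encHomRec-not-single stars I true)
  ... | inj₁ (a , b , c , refl)
    with refl ← encHomRec-injective stars I (inst a b c) (trans eq (sym (encHomRec-inst a b c))) =
    a , b , c , refl , extract a b c yes

theorem14 : Σ (List CGraph) λ 𝓕 → All IsStar 𝓕 × (QPoly ≤ₚ HomRec 𝓕)
theorem14 = stars , map⁺ {f = star} (universal star-isStar shapes) , transduce , transduce-polyTime , QPoly⇔HomRec
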